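{- Let $F\colon\mathbb{F}_2^n\to\mathbb{F}_2^3$ be a bent function. Then there are only four possible preimage distributions for $F$: the type $(+)$ distribution (one preimage set of size $2^{n-3}+2^{n/2}-2^{n/2-3}$ and seven of size $2^{n-3}-2^{n/2-3}$), the type $(-)$ distribution (one preimage set of size $2^{n-3}-2^{n/2}+2^{n/2-3}$ and seven of size $2^{n-3}+2^{n/2-3}$), and the two distributions whose preimage set sizes are $X_i=2^{n-3}+2^{n/2-3}(2T_i-1)$, $i=1,\dots,8$, where $$T_1=-2,\ T_2=T_3=T_4=2,\ T_5=\dots=T_8=0,$$ or $$T_1=3,\ T_2=T_3=T_4=-1,\ T_5=\dots=T_8=1.$$
   Context: A function $F\colon\mathbb{F}_2^n\to\mathbb{F}_2^m$ is bent (perfect nonlinear) if $|\{x: F(x+a)-F(x)=b\}|=2^{n-m}$ for all nonzero $a\in\mathbb{F}_2^n$ and all $b\in\mathbb{F}_2^m$. The preimage distribution of $F$ is the multiset $\{X_1,\dots,X_{2^m}\}$ of the sizes $|F^{ -1}(\beta)|$, $\beta\in\mathbb{F}_2^m$; it is described up to reordering. The theorem asserts that the preimage distribution of every such $F$ is one of the four listed. -}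

module Defs where

open import Algebra.Bundles using (Ring)
open import Data.Integer.Base as ℤ using (ℤ; +_; -[1+_])
open import Data.List.Base
  using (List; []; _∷_; cartesianProductWith; filter; length; map; replicate)
open import Data.Nat.Base as ℕ using (ℕ; zero; suc)
open import Data.Nat.Properties using (m^n≢0)
open import Data.Parity.Base using (Parity; 0ℙ; 1ℙ)
import Data.Parity.Properties as ℙ
open import Data.Rational.Base using (ℚ; _/_; _+_; _-_; _*_)
open import Data.Vec.Base as Vec using (Vec; []; _∷_; zipWith)
open import Data.Vec.Properties using (≡-dec)
open import Relation.Binary.Definitions using (DecidableEquality)
open import Relation.Binary.PropositionalEquality.Core using (_≡_; _≢_)
open import Relation.Unary using (Pred; Decidable)

-- The field with two elements is the library's ring of parities.
module 𝔽₂ = Ring ℙ.+-*-ring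

infix  8 𝔽₂^_
infixl 6 _⊕_ _⊖_
infix  4 _≟_

𝔽₂^_ : ℕ → Set
𝔽₂^ n = Vec Parity n

𝟎 : ∀ {n} → 𝔽₂^ n
𝟎 {n} = Vec.replicate n 0ℙ

_⊕_ _⊖_ : ∀ {n} → 𝔽₂^ n → 𝔽₂^ n → 𝔽₂^ n
_⊕_ = zipWith 𝔽₂._+_
_⊖_ = zipWith 𝔽₂._-_

_≟_ : ∀ {n} → DecidableEquality (𝔽₂^ n)
_≟_ = ≡-dec ℙ._≟_

-- Every vector of 𝔽₂^ n, listed exactly once.
vectors : ∀ n → List (𝔽₂^ n)
vectors zero    = [] ∷ []
vectors (suc n) = cartesianProductWith _∷_ (0ℙ ∷ 1ℙ ∷ []) (vectors n)

-- The number of vectors in 𝔽₂^ n satisfying P.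
count : ∀ {n p} {P : Pred (𝔽₂^ n) p} → Decidable P → ℕ
count {n} P? = length (filter P? (vectors n))

fromℕ : ℕ → ℚ
fromℕ c = + c / 1

fromℤ : ℤ → ℚ
fromℤ i = i / 1

-- Powers of two with a possibly negative exponent: n - m and n/2 - 3 are
-- differences of integers, not truncated differences.
2^ : ℤ → ℚ
2^ (+ e)    = + (2 ℕ.^ e) / 1
2^ -[1+ e ] = _/_ (+ 1) (2 ℕ.^ suc e) {{m^n≢0 2 (suc e)}}

Bent : ∀ {n m} → (𝔽₂^ n → 𝔽₂^ m) → Set
Bent {n} {m} F = (a : 𝔽₂^ n) → a ≢ 𝟎 → (b : 𝔽₂^ m) →
  fromℕ (count (λ x → (F (x ⊕ a) ⊖ F x) ≟ b)) ≡ 2^ (+ n ℤ.- + m)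

-- Multisets of sizes are lists, to be compared up to permutation.  The sizes
-- are cast to ℚ because the formulas below are a priori only rational.
preimageDistribution : ∀ {n m} → (𝔽₂^ n → 𝔽₂^ m) → List ℚ
preimageDistribution {n} {m} F =
  map (λ β → fromℕ (count (λ x → F x ≟ β))) (vectors m)

-- In what follows k stands for n/2.  When n is odd, 2^{n/2} is irrational and
-- none of the four formulas gives eight natural numbers, so a distribution of
-- one of these forms entails the existence of k with n ≡ 2 * k.

type⁺ type⁻ : (n k : ℕ) → List ℚ
type⁺ n k = (2^ (+ n ℤ.- + 3) + 2^ (+ k) - 2^ (+ k ℤ.- + 3))
          ∷ replicate 7 (2^ (+ n ℤ.- + 3) - 2^ (+ k ℤ.- + 3))
type⁻ n k = (2^ (+ n ℤ.- + 3) - 2^ (+ k) + 2^ (+ k ℤ.- + 3))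
          ∷ replicate 7 (2^ (+ n ℤ.- + 3) + 2^ (+ k ℤ.- + 3))

fromT : (n k : ℕ) → List ℤ → List ℚ
fromT n k = map λ T →
  2^ (+ n ℤ.- + 3) + 2^ (+ k ℤ.- + 3) * fromℤ (+ 2 ℤ.* T ℤ.- + 1)

Tᴬ Tᴮ : List ℤ
Tᴬ = ℤ.- + 2 ∷ + 2 ∷ + 2 ∷ + 2 ∷ + 0 ∷ + 0 ∷ + 0 ∷ + 0 ∷ []
Tᴮ = + 3 ∷ ℤ.- + 1 ∷ ℤ.- + 1 ∷ ℤ.- + 1 ∷ + 1 ∷ + 1 ∷ + 1 ∷ + 1 ∷ []

{-# OPTIONS --safe #-}
module Submission where

-- For u ≠ 0 the character sum W(u) = Σ_x (-1)^{u·F(x)} satisfies W(u)² = 2^n, since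
-- all derivatives of F in nonzero directions are balanced.  Hence n = 2k and
-- W(u) = ±2^k, while W(0) = 2^n.  Giving the trivial character the sign +, Fourier
-- inversion yields 8 X_β = 2^n + 2^k (S_β - 1), where S is the Walsh spectrum of the
-- function of signs, so S_β = 2 T_β.  Every one of the 2^7 possible functions of
-- signs has one of four spectra, up to order.

open import Defs
open import Data.Bool.Base using (true; false; if_then_else_)
open import Data.Integer.Base as ℤ using (ℤ; +_; 0ℤ; 1ℤ; -1ℤ; ∣_∣)
import Data.Integer.Properties as ℤ
import Data.Integer.Tactic.RingSolver as ℤSolver
open import Data.List.Base as List using (List; []; _∷_; _++_; filter; length; replicate)
open import Data.List.Relation.Binary.Permutation.Propositional using (_↭_; ↭-reflexive; ↭-sym; ↭-trans)
open import Data.List.Relation.Binary.Permutation.Propositional.Properties using (map⁺)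
import Data.List.Properties as List
open import Data.List.Relation.Unary.Any as Any using (Any; here; there; any?)
open import Data.List.Sort.Base ℤ.≤-totalOrder using (module SortingAlgorithm)
open import Data.List.Sort.InsertionSort ℤ.≤-decTotalOrder using (insertionSort)
open import Data.Nat.Base as ℕ using (ℕ; zero; suc; _^_; _*_)
open import Data.Nat.Divisibility using (_∣_; divides-refl; m∣m*n)
open import Data.Nat.Primality using (prime[2]; euclidsLemma)
import Data.Nat.Properties as ℕ
import Data.Nat.Tactic.RingSolver as ℕSolver
open import Data.Parity.Base using (Parity; 0ℙ; 1ℙ)
import Data.Parity.Properties as ℙ
open import Data.Product.Base using (_×_; _,_; ∃-syntax; proj₁; proj₂)
open import Data.Rational.Base as ℚ using (ℚ; _/_; toℚᵘ)
import Data.Rational.Properties as ℚ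
open import Data.Rational.Solver using (module +-*-Solver)
import Data.Rational.Unnormalised.Base as ℚᵘ
import Data.Rational.Unnormalised.Properties as ℚᵘ
open import Data.Sum.Base as Sum using (_⊎_; inj₁; inj₂)
open import Data.Vec.Base using ([]; _∷_)
open import Function.Base using (_∘_)
open import Relation.Binary.PropositionalEquality
open import Relation.Nullary.Decidable
  using (Dec; yes; no; does; dec-false; map′; toWitness; _×-dec_; _→-dec_)
open import Relation.Nullary.Negation using (¬_; contradiction)
open import Relation.Unary using (Pred; Decidable)

open SortingAlgorithm insertionSort using (sort; sort-↭)

-- Sums over all vectors

∑ : ∀ {n} → (𝔽₂^ n → ℤ) → ℤ
∑ {zero}  f = f []
∑ {suc n} f = ∑ (f ∘ (0ℙ ∷_)) ℤ.+ ∑ (f ∘ (1ℙ ∷_))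

infix 7 ∑-syntax
∑-syntax : ∀ {n} → (𝔽₂^ n → ℤ) → ℤ
∑-syntax = ∑
syntax ∑-syntax (λ x → e) = ∑[ x ] e

∑-cong : ∀ {n} {f g : 𝔽₂^ n → ℤ} → f ≗ g → ∑ f ≡ ∑ g
∑-cong {zero}  f≗g = f≗g []
∑-cong {suc n} f≗g = cong₂ ℤ._+_ (∑-cong (f≗g ∘ (0ℙ ∷_))) (∑-cong (f≗g ∘ (1ℙ ∷_)))

+-interchange : ∀ a b c d → (a ℤ.+ b) ℤ.+ (c ℤ.+ d) ≡ (a ℤ.+ c) ℤ.+ (b ℤ.+ d)
+-interchange = ℤSolver.solve-∀

∑-+ : ∀ {n} (f g : 𝔽₂^ n → ℤ) → ∑[ x ] (f x ℤ.+ g x) ≡ ∑ f ℤ.+ ∑ g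
∑-+ {zero}  f g = refl
∑-+ {suc n} f g = trans
  (cong₂ ℤ._+_ (∑-+ (f ∘ (0ℙ ∷_)) (g ∘ (0ℙ ∷_))) (∑-+ (f ∘ (1ℙ ∷_)) (g ∘ (1ℙ ∷_))))
  (+-interchange (∑ (f ∘ (0ℙ ∷_))) _ _ _)

∑-*ˡ : ∀ {n} c (f : 𝔽₂^ n → ℤ) → ∑[ x ] (c ℤ.* f x) ≡ c ℤ.* ∑ f
∑-*ˡ {zero}  c f = refl
∑-*ˡ {suc n} c f = trans
  (cong₂ ℤ._+_ (∑-*ˡ c (f ∘ (0ℙ ∷_))) (∑-*ˡ c (f ∘ (1ℙ ∷_))))
  (sym (ℤ.*-distribˡ-+ c _ _))

∑-*ʳ : ∀ {n} c (f : 𝔽₂^ n → ℤ) → ∑[ x ] (f x ℤ.* c) ≡ ∑ f ℤ.* c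
∑-*ʳ c f = begin
  ∑[ x ] (f x ℤ.* c)  ≡⟨ ∑-cong (λ x → ℤ.*-comm (f x) c) ⟩
  ∑[ x ] (c ℤ.* f x)  ≡⟨ ∑-*ˡ c f ⟩
  c ℤ.* ∑ f           ≡⟨ ℤ.*-comm c _ ⟩
  ∑ f ℤ.* c           ∎
  where open ≡-Reasoning

∑-swap : ∀ {m n} (f : 𝔽₂^ m → 𝔽₂^ n → ℤ) →
  ∑[ x ] (∑[ y ] f x y) ≡ ∑[ y ] (∑[ x ] f x y)
∑-swap {zero}  f = refl
∑-swap {suc m} f = trans
  (cong₂ ℤ._+_ (∑-swap (f ∘ (0ℙ ∷_))) (∑-swap (f ∘ (1ℙ ∷_))))
  (sym (∑-+ (λ y → ∑[ x ] f (0ℙ ∷ x) y) (λ y → ∑[ x ] f (1ℙ ∷ x) y)))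

-- A leading `1ℙ` in `a` swaps the two halves of the sum.
∑-translate : ∀ {n} (a : 𝔽₂^ n) (f : 𝔽₂^ n → ℤ) → ∑[ x ] f (a ⊕ x) ≡ ∑ f
∑-translate []       f = refl
∑-translate (0ℙ ∷ a) f =
  cong₂ ℤ._+_ (∑-translate a (f ∘ (0ℙ ∷_))) (∑-translate a (f ∘ (1ℙ ∷_)))
∑-translate (1ℙ ∷ a) f = trans
  (cong₂ ℤ._+_ (∑-translate a (f ∘ (1ℙ ∷_))) (∑-translate a (f ∘ (0ℙ ∷_))))
  (ℤ.+-comm (∑ (f ∘ (1ℙ ∷_))) _)

∑-const-1 : ∀ n → ∑ {n} (λ _ → 1ℤ) ≡ + (2 ^ n)
∑-const-1 zero    = refl
∑-const-1 (suc n) = begin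
  ∑ {n} (λ _ → 1ℤ) ℤ.+ ∑ {n} (λ _ → 1ℤ)  ≡⟨ cong₂ ℤ._+_ (∑-const-1 n) (∑-const-1 n) ⟩
  + (2 ^ n ℕ.+ 2 ^ n)                    ≡⟨ cong (λ z → + (2 ^ n ℕ.+ z)) (sym (ℕ.+-identityʳ _)) ⟩
  + (2 ^ suc n)                          ∎
  where open ≡-Reasoning

-- Indicators and counting by fibres

𝟙 : ∀ {p} {P : Set p} → Dec P → ℤ
𝟙 P? = if does P? then 1ℤ else 0ℤ

𝟙-no : ∀ {p} {P : Set p} (P? : Dec P) → ¬ P → 𝟙 P? ≡ 0ℤ
𝟙-no P? ¬p = cong (if_then 1ℤ else 0ℤ) (dec-false P? ¬p)

length-filter-map : ∀ {a b p} {A : Set a} {B : Set b} {P : Pred B p}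
  (P? : Decidable P) (f : A → B) xs →
  length (filter P? (List.map f xs)) ≡ length (filter (P? ∘ f) xs)
length-filter-map P? f []       = refl
length-filter-map P? f (x ∷ xs) with does (P? (f x))
... | true  = cong suc (length-filter-map P? f xs)
... | false = length-filter-map P? f xs

count-suc : ∀ {n p} {P : Pred (𝔽₂^ suc n) p} (P? : Decidable P) →
  count P? ≡ count (P? ∘ (0ℙ ∷_)) ℕ.+ count (P? ∘ (1ℙ ∷_))
count-suc {n} P? = begin
  length (filter P? (v₀ ++ v₁ ++ []))                ≡⟨ cong (λ vs → length (filter P? (v₀ ++ vs))) (List.++-identityʳ v₁) ⟩
  length (filter P? (v₀ ++ v₁))                      ≡⟨ cong length (List.filter-++ P? v₀ v₁) ⟩
  length (filter P? v₀ ++ filter P? v₁)              ≡⟨ List.length-++ (filter P? v₀) ⟩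
  length (filter P? v₀) ℕ.+ length (filter P? v₁)    ≡⟨ cong₂ ℕ._+_ (length-filter-map P? (0ℙ ∷_) (vectors n)) (length-filter-map P? (1ℙ ∷_) (vectors n)) ⟩
  count (P? ∘ (0ℙ ∷_)) ℕ.+ count (P? ∘ (1ℙ ∷_))      ∎
  where
  open ≡-Reasoning
  v₀ = List.map (0ℙ ∷_) (vectors n)
  v₁ = List.map (1ℙ ∷_) (vectors n)

+count≡∑ : ∀ {n p} {P : Pred (𝔽₂^ n) p} (P? : Decidable P) →
  + count P? ≡ ∑[ x ] 𝟙 (P? x)
+count≡∑ {zero}  P? with does (P? [])
... | true  = refl
... | false = refl
+count≡∑ {suc n} P? = trans (cong +_ (count-suc P?))
  (cong₂ ℤ._+_ (+count≡∑ (P? ∘ (0ℙ ∷_))) (+count≡∑ (P? ∘ (1ℙ ∷_))))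

∑-0 : ∀ {n} (f : 𝔽₂^ n → ℤ) → ∑[ x ] (f x ℤ.* 0ℤ) ≡ 0ℤ
∑-0 f = trans (∑-*ʳ 0ℤ f) (ℤ.*-zeroʳ (∑ f))

-- `𝟙` only inspects `does`, so it computes on leading entries: it vanishes on the half where they
-- differ and becomes the indicator of the tails on the other.
∑-𝟙 : ∀ {n} (a : 𝔽₂^ n) (f : 𝔽₂^ n → ℤ) → ∑[ x ] (f x ℤ.* 𝟙 (a ≟ x)) ≡ f a
∑-𝟙 []       f = ℤ.*-identityʳ (f [])
∑-𝟙 (0ℙ ∷ a) f = trans
  (cong₂ ℤ._+_ (∑-𝟙 a (f ∘ (0ℙ ∷_))) (∑-0 (f ∘ (1ℙ ∷_)))) (ℤ.+-identityʳ _)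
∑-𝟙 (1ℙ ∷ a) f = trans
  (cong₂ ℤ._+_ (∑-0 (f ∘ (0ℙ ∷_))) (∑-𝟙 a (f ∘ (1ℙ ∷_)))) (ℤ.+-identityˡ _)

-- Insert the indicators of the fibres and sum over `x` first. This is how counts enter the
-- character sums.
∑-fibres : ∀ {n m} (G : 𝔽₂^ n → 𝔽₂^ m) (f : 𝔽₂^ m → ℤ) →
  ∑[ x ] f (G x) ≡ ∑[ β ] (f β ℤ.* + count (λ x → G x ≟ β))
∑-fibres G f = begin
  ∑[ x ] f (G x)                                 ≡⟨ ∑-cong (λ x → ∑-𝟙 (G x) f) ⟨
  ∑[ x ] (∑[ β ] (f β ℤ.* 𝟙 (G x ≟ β)))          ≡⟨ ∑-swap (λ x β → f β ℤ.* 𝟙 (G x ≟ β)) ⟩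
  ∑[ β ] (∑[ x ] (f β ℤ.* 𝟙 (G x ≟ β)))          ≡⟨ ∑-cong (λ β → ∑-*ˡ (f β) (λ x → 𝟙 (G x ≟ β))) ⟩
  ∑[ β ] (f β ℤ.* (∑[ x ] 𝟙 (G x ≟ β)))          ≡⟨ ∑-cong (λ β → cong (f β ℤ.*_) (+count≡∑ (λ x → G x ≟ β))) ⟨
  ∑[ β ] (f β ℤ.* + count (λ x → G x ≟ β))       ∎
  where open ≡-Reasoning

-- Characters and their orthogonality

sgn : Parity → ℤ
sgn 0ℙ = 1ℤ
sgn 1ℙ = -1ℤ

-- The character (-1)^(u·v); the product form follows the recursion of `∑`.
χ : ∀ {n} → 𝔽₂^ n → 𝔽₂^ n → ℤ
χ []      []      = 1ℤ
χ (p ∷ u) (q ∷ v) = sgn (p 𝔽₂.* q) ℤ.* χ u v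

χ-sym : ∀ {n} (u v : 𝔽₂^ n) → χ u v ≡ χ v u
χ-sym []      []      = refl
χ-sym (p ∷ u) (q ∷ v) = cong₂ ℤ._*_ (cong sgn (ℙ.*-comm p q)) (χ-sym u v)

χ-𝟎 : ∀ {n} (u : 𝔽₂^ n) → χ u 𝟎 ≡ 1ℤ
χ-𝟎 []       = refl
χ-𝟎 (0ℙ ∷ u) = trans (ℤ.*-identityˡ _) (χ-𝟎 u)
χ-𝟎 (1ℙ ∷ u) = trans (ℤ.*-identityˡ _) (χ-𝟎 u)

sgn-⊖ : ∀ p q r → sgn (p 𝔽₂.* (q 𝔽₂.- r)) ≡ sgn (p 𝔽₂.* q) ℤ.* sgn (p 𝔽₂.* r)
sgn-⊖ 0ℙ q  r  = refl
sgn-⊖ 1ℙ 0ℙ 0ℙ = refl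
sgn-⊖ 1ℙ 0ℙ 1ℙ = refl
sgn-⊖ 1ℙ 1ℙ 0ℙ = refl
sgn-⊖ 1ℙ 1ℙ 1ℙ = refl

*-interchange : ∀ a b c d → (a ℤ.* b) ℤ.* (c ℤ.* d) ≡ (a ℤ.* c) ℤ.* (b ℤ.* d)
*-interchange = ℤSolver.solve-∀

χ-⊖ : ∀ {n} (u v w : 𝔽₂^ n) → χ u (v ⊖ w) ≡ χ u v ℤ.* χ u w
χ-⊖ []      []      []      = refl
χ-⊖ (p ∷ u) (q ∷ v) (r ∷ w) = trans
  (cong₂ ℤ._*_ (sgn-⊖ p q r) (χ-⊖ u v w))
  (*-interchange (sgn (p 𝔽₂.* q)) _ _ _)

sgn-square : ∀ p → sgn p ℤ.* sgn p ≡ 1ℤ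
sgn-square 0ℙ = refl
sgn-square 1ℙ = refl

χ-square : ∀ {n} (u v : 𝔽₂^ n) → χ u v ℤ.* χ u v ≡ 1ℤ
χ-square []      []      = refl
χ-square (p ∷ u) (q ∷ v) = trans
  (*-interchange (sgn (p 𝔽₂.* q)) _ _ _)
  (cong₂ ℤ._*_ (sgn-square (p 𝔽₂.* q)) (χ-square u v))

-- The leading entries contribute 1 + 1 when `p` and `q` agree and 1 - 1 when they differ, so the
-- sum over the tails doubles or cancels.
χ-orthogonal : ∀ {n} (v w : 𝔽₂^ n) →
  ∑[ u ] (χ v u ℤ.* χ w u) ≡ + (2 ^ n) ℤ.* 𝟙 (v ≟ w)
χ-orthogonal []      []      = refl
χ-orthogonal {suc n} (p ∷ v) (q ∷ w) = begin
  ∑[ u ] ((s₀ p ℤ.* χ v u) ℤ.* (s₀ q ℤ.* χ w u)) ℤ.+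
  ∑[ u ] ((s₁ p ℤ.* χ v u) ℤ.* (s₁ q ℤ.* χ w u))   ≡⟨ cong₂ ℤ._+_ (pull (s₀ p) (s₀ q)) (pull (s₁ p) (s₁ q)) ⟩
  s₀ p ℤ.* s₀ q ℤ.* Σ ℤ.+ s₁ p ℤ.* s₁ q ℤ.* Σ      ≡⟨ cong (λ z → s₀ p ℤ.* s₀ q ℤ.* z ℤ.+ s₁ p ℤ.* s₁ q ℤ.* z) (χ-orthogonal v w) ⟩
  s₀ p ℤ.* s₀ q ℤ.* (N ℤ.* 𝟙 (v ≟ w)) ℤ.+
  s₁ p ℤ.* s₁ q ℤ.* (N ℤ.* 𝟙 (v ≟ w))              ≡⟨ step p q ⟩
  (N ℤ.+ N) ℤ.* 𝟙 (p ∷ v ≟ q ∷ w)                  ≡⟨ cong (λ z → + (2 ^ n ℕ.+ z) ℤ.* 𝟙 (p ∷ v ≟ q ∷ w)) (sym (ℕ.+-identityʳ _)) ⟩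
  + (2 ^ suc n) ℤ.* 𝟙 (p ∷ v ≟ q ∷ w)              ∎
  where
  open ≡-Reasoning
  s₀ s₁ : Parity → ℤ
  s₀ p = sgn (p 𝔽₂.* 0ℙ)
  s₁ p = sgn (p 𝔽₂.* 1ℙ)
  Σ = ∑[ u ] (χ v u ℤ.* χ w u)
  N = + (2 ^ n)
  pull : ∀ a b → ∑[ u ] ((a ℤ.* χ v u) ℤ.* (b ℤ.* χ w u)) ≡ a ℤ.* b ℤ.* Σ
  pull a b = trans
    (∑-cong (λ u → *-interchange a (χ v u) b (χ w u)))
    (∑-*ˡ (a ℤ.* b) (λ u → χ v u ℤ.* χ w u))
  same : ∀ N δ → 1ℤ ℤ.* (N ℤ.* δ) ℤ.+ 1ℤ ℤ.* (N ℤ.* δ) ≡ (N ℤ.+ N) ℤ.* δ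
  same = ℤSolver.solve-∀
  opp : ∀ N δ → 1ℤ ℤ.* (N ℤ.* δ) ℤ.+ -1ℤ ℤ.* (N ℤ.* δ) ≡ (N ℤ.+ N) ℤ.* 0ℤ
  opp = ℤSolver.solve-∀
  step : ∀ p q →
    s₀ p ℤ.* s₀ q ℤ.* (N ℤ.* 𝟙 (v ≟ w)) ℤ.+ s₁ p ℤ.* s₁ q ℤ.* (N ℤ.* 𝟙 (v ≟ w)) ≡
    (N ℤ.+ N) ℤ.* 𝟙 (p ∷ v ≟ q ∷ w)
  step 0ℙ 0ℙ = same N (𝟙 (v ≟ w))
  step 0ℙ 1ℙ = opp N (𝟙 (v ≟ w))
  step 1ℙ 0ℙ = opp N (𝟙 (v ≟ w))
  step 1ℙ 1ℙ = same N (𝟙 (v ≟ w))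

∑-χ : ∀ {n} (u : 𝔽₂^ n) → u ≢ 𝟎 → ∑[ b ] χ u b ≡ 0ℤ
∑-χ {n} u u≢𝟎 = begin
  ∑[ b ] χ u b               ≡⟨ ∑-cong (λ b → trans (sym (ℤ.*-identityʳ _)) (cong (χ u b ℤ.*_) (sym (trans (χ-sym 𝟎 b) (χ-𝟎 b))))) ⟩
  ∑[ b ] (χ u b ℤ.* χ 𝟎 b)   ≡⟨ χ-orthogonal u 𝟎 ⟩
  + (2 ^ n) ℤ.* 𝟙 (u ≟ 𝟎)    ≡⟨ cong (+ (2 ^ n) ℤ.*_) (𝟙-no (u ≟ 𝟎) u≢𝟎) ⟩
  + (2 ^ n) ℤ.* 0ℤ           ≡⟨ ℤ.*-zeroʳ (+ (2 ^ n)) ⟩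
  0ℤ                         ∎
  where open ≡-Reasoning

-- Walsh coefficients of bent functions

fromℤ-injective : ∀ {i j} → fromℤ i ≡ fromℤ j → i ≡ j
fromℤ-injective {i} {j} eq with ℚᵘ.*≡* p ← ℚ./-injective-≃ (ℚᵘ.mkℚᵘ i 0) (ℚᵘ.mkℚᵘ j 0) eq =
  trans (sym (ℤ.*-identityʳ i)) (trans p (ℤ.*-identityʳ j))

⊕-identityʳ : ∀ {n} (x : 𝔽₂^ n) → x ⊕ 𝟎 ≡ x
⊕-identityʳ []      = refl
⊕-identityʳ (p ∷ x) = cong₂ _∷_ (ℙ.+-identityʳ p) (⊕-identityʳ x)

walsh : ∀ {n m} → (𝔽₂^ n → 𝔽₂^ m) → 𝔽₂^ m → ℤ
walsh G u = ∑[ x ] χ u (G x)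

derivative : ∀ {n m} → (𝔽₂^ n → 𝔽₂^ m) → 𝔽₂^ n → 𝔽₂^ n → 𝔽₂^ m
derivative F a x = F (x ⊕ a) ⊖ F x

module _ {n m} (F : 𝔽₂^ n → 𝔽₂^ m) (bent : Bent F) (u : 𝔽₂^ m) (u≢𝟎 : u ≢ 𝟎) where

  open ≡-Reasoning

  -- For nonzero `a` bentness makes all fibres of the derivative equal in size, so the sum is a
  -- multiple of the vanishing total of `χ u`. For `a` zero every summand is 1.
  walsh-derivative : ∀ a → walsh (derivative F a) u ≡ + (2 ^ n) ℤ.* 𝟙 (𝟎 ≟ a)
  walsh-derivative a = by-cases a (𝟎 ≟ a)
    where
    trivial : ∀ x → χ u (derivative F 𝟎 x) ≡ 1ℤ
    trivial x = begin
      χ u (F (x ⊕ 𝟎) ⊖ F x)       ≡⟨ cong (λ y → χ u (F y ⊖ F x)) (⊕-identityʳ x) ⟩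
      χ u (F x ⊖ F x)             ≡⟨ χ-⊖ u (F x) (F x) ⟩
      χ u (F x) ℤ.* χ u (F x)     ≡⟨ χ-square u (F x) ⟩
      1ℤ                          ∎

    N : 𝔽₂^ n → 𝔽₂^ m → ℤ
    N a b = + count (λ x → derivative F a x ≟ b)

    -- The counts are compared in ℚ, where `Bent` states them, and brought back to ℤ by injectivity.
    balanced : ∀ {a} → a ≢ 𝟎 → ∀ b → N a b ≡ N a 𝟎
    balanced {a} a≢𝟎 b = fromℤ-injective (trans (bent a a≢𝟎 b) (sym (bent a a≢𝟎 𝟎)))

    -- The decision is an argument, so that matching on it evaluates the indicator in the goal.
    by-cases : ∀ a (𝟎≟a : Dec (𝟎 ≡ a)) → walsh (derivative F a) u ≡ + (2 ^ n) ℤ.* 𝟙 𝟎≟a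
    by-cases a (yes refl) = begin
      ∑[ x ] χ u (derivative F 𝟎 x)  ≡⟨ ∑-cong trivial ⟩
      ∑ {n} (λ _ → 1ℤ)               ≡⟨ ∑-const-1 n ⟩
      + (2 ^ n)                      ≡⟨ ℤ.*-identityʳ _ ⟨
      + (2 ^ n) ℤ.* 1ℤ               ∎
    by-cases a (no 𝟎≢a) = begin
      ∑[ x ] χ u (derivative F a x)  ≡⟨ ∑-fibres (derivative F a) (χ u) ⟩
      ∑[ b ] (χ u b ℤ.* N a b)       ≡⟨ ∑-cong (λ b → cong (χ u b ℤ.*_) (balanced (𝟎≢a ∘ sym) b)) ⟩
      ∑[ b ] (χ u b ℤ.* N a 𝟎)       ≡⟨ ∑-*ʳ (N a 𝟎) (χ u) ⟩
      ∑ (χ u) ℤ.* N a 𝟎              ≡⟨ cong (ℤ._* N a 𝟎) (∑-χ u u≢𝟎) ⟩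
      0ℤ                             ≡⟨ ℤ.*-zeroʳ (+ (2 ^ n)) ⟨
      + (2 ^ n) ℤ.* 0ℤ               ∎

  -- The product of the values of `f` at `x ⊕ a` and `x` is a character value of the derivative in
  -- direction `a`. Summed over `x`, only the direction `𝟎` survives.
  walsh-square : walsh F u ℤ.* walsh F u ≡ + (2 ^ n)
  walsh-square = begin
    W ℤ.* W                                        ≡⟨ ∑-*ˡ W f ⟨
    -- For each `x` separately, `W` is rewritten as a sum over the differences `a`.
    ∑[ x ] (W ℤ.* f x)                             ≡⟨ ∑-cong (λ x → cong (ℤ._* f x) (∑-translate x f)) ⟨
    ∑[ x ] ((∑[ a ] f (x ⊕ a)) ℤ.* f x)            ≡⟨ ∑-cong (λ x → ∑-*ʳ (f x) (λ a → f (x ⊕ a))) ⟨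
    ∑[ x ] (∑[ a ] (f (x ⊕ a) ℤ.* f x))            ≡⟨ ∑-cong (λ x → ∑-cong (λ a → χ-⊖ u (F (x ⊕ a)) (F x))) ⟨
    ∑[ x ] (∑[ a ] χ u (derivative F a x))         ≡⟨ ∑-swap (λ x a → χ u (derivative F a x)) ⟩
    ∑[ a ] walsh (derivative F a) u                ≡⟨ ∑-cong walsh-derivative ⟩
    ∑ {n} (λ a → + (2 ^ n) ℤ.* 𝟙 (𝟎 ≟ a))          ≡⟨ ∑-𝟙 {n} 𝟎 (λ _ → + (2 ^ n)) ⟩
    + (2 ^ n)                                      ∎
    where
    f = λ x → χ u (F x)
    W = walsh F u

-- Orthogonality writes `2 ^ m` times the indicator of `F x ≡ β` as a sum over characters;
-- exchanging the sums gives Fourier inversion.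
walsh-inversion : ∀ {n m} (F : 𝔽₂^ n → 𝔽₂^ m) β →
  + (2 ^ m) ℤ.* + count (λ x → F x ≟ β) ≡ ∑[ u ] (χ β u ℤ.* walsh F u)
walsh-inversion {n} {m} F β = begin
  + (2 ^ m) ℤ.* + count (λ x → F x ≟ β)              ≡⟨ cong (+ (2 ^ m) ℤ.*_) (+count≡∑ (λ x → F x ≟ β)) ⟩
  + (2 ^ m) ℤ.* (∑[ x ] 𝟙 (F x ≟ β))                 ≡⟨ ∑-*ˡ (+ (2 ^ m)) (λ x → 𝟙 (F x ≟ β)) ⟨
  ∑[ x ] (+ (2 ^ m) ℤ.* 𝟙 (F x ≟ β))                 ≡⟨ ∑-cong (λ x → χ-orthogonal (F x) β) ⟨
  ∑[ x ] (∑[ u ] (χ (F x) u ℤ.* χ β u))              ≡⟨ ∑-swap (λ x u → χ (F x) u ℤ.* χ β u) ⟩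
  ∑[ u ] (∑[ x ] (χ (F x) u ℤ.* χ β u))              ≡⟨ ∑-cong (λ u → ∑-*ʳ (χ β u) (λ x → χ (F x) u)) ⟩
  ∑[ u ] ((∑[ x ] χ (F x) u) ℤ.* χ β u)              ≡⟨ ∑-cong (λ u → ℤ.*-comm _ (χ β u)) ⟩
  ∑[ u ] (χ β u ℤ.* (∑[ x ] χ (F x) u))              ≡⟨ ∑-cong (λ u → cong (χ β u ℤ.*_) (∑-cong (λ x → χ-sym (F x) u))) ⟩
  ∑[ u ] (χ β u ℤ.* walsh F u)                       ∎
  where open ≡-Reasoning

walsh-𝟎 : ∀ {n m} (F : 𝔽₂^ n → 𝔽₂^ m) → walsh F 𝟎 ≡ + (2 ^ n)
walsh-𝟎 {n} F = trans (∑-cong (λ x → trans (χ-sym 𝟎 (F x)) (χ-𝟎 (F x)))) (∑-const-1 n)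

-- Walsh signs and the fibre sizes they determine

even-square : ∀ v → 2 * (v * v * 2) ≡ v * 2 * (v * 2)
even-square = ℕSolver.solve-∀

m*2≢1 : ∀ m → m * 2 ≢ 1
m*2≢1 zero    ()
m*2≢1 (suc m) ()

-- Descent by two in the exponent: 2 divides `w * w`, hence `w` is 2v, and cancelling 4 leaves v² as
-- a power of two. Exponent one is impossible, as it would give 2v² = 1.
√2^n : ∀ n w → w * w ≡ 2 ^ n → ∃[ k ] (n ≡ 2 * k × w ≡ 2 ^ k)
√2^n zero    w w²≡1 = 0 , refl , ℕ.m*n≡1⇒m≡1 w w w²≡1
√2^n (suc n) w w²≡ with Sum.reduce (euclidsLemma w w prime[2] (subst (2 ∣_) (sym w²≡) (m∣m*n (2 ^ n))))
... | divides-refl v with n | ℕ.*-cancelˡ-≡ (v * v * 2) (2 ^ n) 2 (trans (even-square v) w²≡)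
...   | zero  | v²*2≡1 = contradiction v²*2≡1 (m*2≢1 (v * v))
...   | suc n | v²*2≡
  with k , refl , refl ← √2^n n v (ℕ.*-cancelʳ-≡ (v * v) (2 ^ n) 2 (trans v²*2≡ (ℕ.*-comm 2 (2 ^ n))))
  = suc k , sym (ℕ.*-suc 2 k) , ℕ.*-comm (2 ^ k) 2

-- The sign is recorded as a parity, so that sign functions become Boolean functions, open to
-- exhaustive checking.
±-sgn : ∀ i → ∃[ p ] (i ≡ + ∣ i ∣ ℤ.* sgn p)
±-sgn i with ℤ.+∣i∣≡i⊎+∣i∣≡-i i
... | inj₁ eq = 0ℙ , trans (sym eq) (sym (ℤ.*-identityʳ _))
... | inj₂ eq = 1ℙ , (begin
  i                    ≡⟨ ℤ.neg-involutive i ⟨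
  ℤ.- ℤ.- i            ≡⟨ cong ℤ.-_ eq ⟨
  ℤ.- + ∣ i ∣          ≡⟨ ℤ.-1*i≡-i _ ⟨
  -1ℤ ℤ.* + ∣ i ∣      ≡⟨ ℤ.*-comm -1ℤ _ ⟩
  + ∣ i ∣ ℤ.* -1ℤ      ∎)
  where open ≡-Reasoning

walsh-magnitude : ∀ {n m} (F : 𝔽₂^ n → 𝔽₂^ m) → Bent F → ∀ u → u ≢ 𝟎 →
  ∃[ k ] (n ≡ 2 * k × ∣ walsh F u ∣ ≡ 2 ^ k)
walsh-magnitude {n} F bent u u≢𝟎 = √2^n n ∣ walsh F u ∣
  (trans (sym (ℤ.abs-* (walsh F u) (walsh F u))) (cong ∣_∣ (walsh-square F bent u u≢𝟎)))

-- The value 0ℙ at 𝟎 stands for the missing sign of the trivial character, whose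
-- Walsh coefficient 2 ^ (2 * k) is not of size 2 ^ k.
walsh-sign : ∀ {n m} k (F : 𝔽₂^ n → 𝔽₂^ m) → Bent F → n ≡ 2 * k →
  ∀ u (𝟎≟u : Dec (𝟎 ≡ u)) → ∃[ p ]
    ((u ≡ 𝟎 → p ≡ 0ℙ) ×
     walsh F u ≡ + (2 ^ k) ℤ.* sgn p ℤ.+ (+ (2 ^ n) ℤ.- + (2 ^ k)) ℤ.* 𝟙 𝟎≟u)
walsh-sign {n} k F bent n≡2k u (yes refl) =
  0ℙ , (λ _ → refl) , trans (walsh-𝟎 F) (regroup (+ (2 ^ k)) (+ (2 ^ n)))
  where
  regroup : ∀ a b → b ≡ a ℤ.* 1ℤ ℤ.+ (b ℤ.- a) ℤ.* 1ℤ
  regroup = ℤSolver.solve-∀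
walsh-sign {n} k F bent n≡2k u (no 𝟎≢u) = p , (λ u≡𝟎 → contradiction (sym u≡𝟎) 𝟎≢u) , (begin
  walsh F u                                                 ≡⟨ proj₂ (±-sgn (walsh F u)) ⟩
  + ∣ walsh F u ∣ ℤ.* sgn p                                 ≡⟨ cong (λ w → + w ℤ.* sgn p) (magnitude (walsh-magnitude F bent u (𝟎≢u ∘ sym))) ⟩
  + (2 ^ k) ℤ.* sgn p                                       ≡⟨ pad (+ (2 ^ k) ℤ.* sgn p) (+ (2 ^ n) ℤ.- + (2 ^ k)) ⟩
  + (2 ^ k) ℤ.* sgn p ℤ.+ (+ (2 ^ n) ℤ.- + (2 ^ k)) ℤ.* 0ℤ  ∎)
  where
  open ≡-Reasoning
  p = proj₁ (±-sgn (walsh F u))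
  -- Every nonzero `u` comes with an exponent of its own; all of them are half of `n`.
  magnitude : ∃[ k′ ] (n ≡ 2 * k′ × ∣ walsh F u ∣ ≡ 2 ^ k′) → ∣ walsh F u ∣ ≡ 2 ^ k
  magnitude (k′ , n≡2k′ , ∣W∣≡) =
    trans ∣W∣≡ (cong (2 ^_) (ℕ.*-cancelˡ-≡ k′ k 2 (trans (sym n≡2k′) n≡2k)))
  pad : ∀ a b → a ≡ a ℤ.+ b ℤ.* 0ℤ
  pad = ℤSolver.solve-∀

-- In the inversion formula the signs contribute `K ℤ.* S`. The correction at `𝟎` contributes
-- `N ℤ.- K`, because `χ β 𝟎` is 1; this is the source of the -1.
fibre-size : ∀ {n m} k (F : 𝔽₂^ n → 𝔽₂^ m) (f : 𝔽₂^ m → ℤ) →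
  (∀ u → walsh F u ≡ + (2 ^ k) ℤ.* f u ℤ.+ (+ (2 ^ n) ℤ.- + (2 ^ k)) ℤ.* 𝟙 (𝟎 ≟ u)) →
  ∀ β → + (2 ^ m) ℤ.* + count (λ x → F x ≟ β) ≡
    + (2 ^ n) ℤ.+ + (2 ^ k) ℤ.* ((∑[ u ] (χ β u ℤ.* f u)) ℤ.- 1ℤ)
fibre-size {n} {m} k F f W≡ β = begin
  + (2 ^ m) ℤ.* + count (λ x → F x ≟ β)                    ≡⟨ walsh-inversion F β ⟩
  ∑[ u ] (χ β u ℤ.* walsh F u)                             ≡⟨ ∑-cong (λ u → trans (cong (χ β u ℤ.*_) (W≡ u)) (expand (χ β u) K (f u) C (𝟙 (𝟎 ≟ u)))) ⟩
  ∑[ u ] (K ℤ.* (χ β u ℤ.* f u) ℤ.+ C ℤ.* (χ β u ℤ.* 𝟙 (𝟎 ≟ u)))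
                                                           ≡⟨ ∑-+ (λ u → K ℤ.* (χ β u ℤ.* f u)) (λ u → C ℤ.* (χ β u ℤ.* 𝟙 (𝟎 ≟ u))) ⟩
  (∑[ u ] (K ℤ.* (χ β u ℤ.* f u))) ℤ.+ (∑[ u ] (C ℤ.* (χ β u ℤ.* 𝟙 (𝟎 ≟ u))))
                                                           ≡⟨ cong₂ ℤ._+_ (∑-*ˡ K (λ u → χ β u ℤ.* f u)) (∑-*ˡ C (λ u → χ β u ℤ.* 𝟙 (𝟎 ≟ u))) ⟩
  K ℤ.* S ℤ.+ C ℤ.* (∑[ u ] (χ β u ℤ.* 𝟙 (𝟎 ≟ u)))         ≡⟨ cong (λ z → K ℤ.* S ℤ.+ C ℤ.* z) (trans (∑-𝟙 𝟎 (χ β)) (χ-𝟎 β)) ⟩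
  K ℤ.* S ℤ.+ (N ℤ.- K) ℤ.* 1ℤ                             ≡⟨ collect K N S ⟩
  N ℤ.+ K ℤ.* (S ℤ.- 1ℤ)                                   ∎
  where
  open ≡-Reasoning
  K = + (2 ^ k)
  N = + (2 ^ n)
  C = N ℤ.- K
  S = ∑[ u ] (χ β u ℤ.* f u)
  expand : ∀ x K s C d → x ℤ.* (K ℤ.* s ℤ.+ C ℤ.* d) ≡ K ℤ.* (x ℤ.* s) ℤ.+ C ℤ.* (x ℤ.* d)
  expand = ℤSolver.solve-∀
  collect : ∀ K N S → K ℤ.* S ℤ.+ (N ℤ.- K) ℤ.* 1ℤ ≡ N ℤ.+ K ℤ.* (S ℤ.- 1ℤ)
  collect = ℤSolver.solve-∀

-- Exhaustive decision over Boolean functions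

branch : ∀ {n} {A : Set} → (𝔽₂^ n → A) → (𝔽₂^ n → A) → 𝔽₂^ suc n → A
branch f g (0ℙ ∷ x) = f x
branch f g (1ℙ ∷ x) = g x

branch-cong : ∀ {n} {A : Set} {f f′ g g′ : 𝔽₂^ n → A} →
  f ≗ f′ → g ≗ g′ → branch f g ≗ branch f′ g′
branch-cong f≗f′ g≗g′ (0ℙ ∷ x) = f≗f′ x
branch-cong f≗f′ g≗g′ (1ℙ ∷ x) = g≗g′ x

branch-η : ∀ {n} {A : Set} (f : 𝔽₂^ suc n → A) → branch (f ∘ (0ℙ ∷_)) (f ∘ (1ℙ ∷_)) ≗ f
branch-η f (0ℙ ∷ x) = refl
branch-η f (1ℙ ∷ x) = refl

Extensional : ∀ {n p} → Pred (𝔽₂^ n → Parity) p → Set p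
Extensional P = ∀ {f g} → f ≗ g → P f → P g

-- Without function extensionality, a predicate is only decided for all functions
-- through their values, so it has to respect pointwise equality.
∀-function? : ∀ {n p} {P : Pred (𝔽₂^ n → Parity) p} →
  Extensional P → Decidable P → Dec (∀ f → P f)
∀-function? {zero} {P = P} ext P? = map′
  (λ (p₀ , p₁) f → ext (λ { [] → refl }) (by-value p₀ p₁ (f [])))
  (λ p → p (λ _ → 0ℙ) , p (λ _ → 1ℙ))
  (P? (λ _ → 0ℙ) ×-dec P? (λ _ → 1ℙ))
  where
  by-value : P (λ _ → 0ℙ) → P (λ _ → 1ℙ) → ∀ b → P (λ _ → b)
  by-value p₀ p₁ 0ℙ = p₀
  by-value p₀ p₁ 1ℙ = p₁
∀-function? {suc n} ext P? = map′
  (λ p f → ext (branch-η f) (p (f ∘ (0ℙ ∷_)) (f ∘ (1ℙ ∷_))))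
  (λ p f g → p (branch f g))
  (∀-function?
    (λ f≗f′ p g → ext (branch-cong f≗f′ (λ _ → refl)) (p g))
    (λ f → ∀-function?
      (λ g≗g′ → ext (branch-cong (λ _ → refl) g≗g′))
      (λ g → P? (branch f g))))

-- Spectra of sign functions in three variables

-- The types (+) and (-) in the T-parametrisation of the other two distributions.
T⁺ T⁻ : List ℤ
T⁺ = + 4 ∷ replicate 7 (+ 0)
T⁻ = ℤ.- + 3 ∷ replicate 7 (+ 1)

Tᵃˡˡ : List (List ℤ)
Tᵃˡˡ = T⁺ ∷ T⁻ ∷ Tᴬ ∷ Tᴮ ∷ []

-- The Walsh-Hadamard transform of `f`, in the order of `vectors` so that it lines up with
-- `preimageDistribution`.
spectrum : ∀ {n} → (𝔽₂^ n → ℤ) → List ℤ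
spectrum {n} f = List.map (λ β → ∑[ u ] (χ β u ℤ.* f u)) (vectors n)

spectrum-cong : ∀ {n} {f g : 𝔽₂^ n → ℤ} → f ≗ g → spectrum f ≡ spectrum g
spectrum-cong {n} f≗g = List.map-cong (λ β → ∑-cong (λ u → cong (χ β u ℤ.*_) (f≗g u))) (vectors n)

-- Sorting provides a canonical form up to permutation, which turns the comparison into an equality
-- decided by evaluation.
sort-≡⇒↭ : ∀ xs ys → sort xs ≡ sort ys → xs ↭ ys
sort-≡⇒↭ xs ys eq = ↭-trans (↭-sym (sort-↭ xs)) (↭-trans (↭-reflexive eq) (sort-↭ ys))

-- A spectral value S corresponds to T by S = 2T, which turns S - 1 into the 2T - 1 of the
-- statement.
double : List ℤ → List ℤ
double = List.map (+ 2 ℤ.*_)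

-- The values of a spectrum add up to 8 times the sign at `𝟎`. The premise makes this total 8, which
-- rules out the negatives of the four spectra.
SortedSpectrum : (𝔽₂^ 3 → Parity) → Set
SortedSpectrum σ = σ 𝟎 ≡ 0ℙ →
  Any (λ T → sort (spectrum (sgn ∘ σ)) ≡ sort (double T)) Tᵃˡˡ

sortedSpectrum? : Decidable SortedSpectrum
sortedSpectrum? σ = (σ 𝟎 ℙ.≟ 0ℙ) →-dec
  any? (λ T → List.≡-dec ℤ._≟_ (sort (spectrum (sgn ∘ σ))) (sort (double T))) Tᵃˡˡ

sortedSpectrum-ext : Extensional SortedSpectrum
sortedSpectrum-ext f≗g p g𝟎 = Any.map
  (trans (cong sort (spectrum-cong (cong sgn ∘ sym ∘ f≗g))))
  (p (trans (f≗g 𝟎) g𝟎))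

-- By evaluation on all 128 functions with σ 𝟎 ≡ 0ℙ.
sortedSpectrum : ∀ σ → SortedSpectrum σ
sortedSpectrum = toWitness {a? = ∀-function? sortedSpectrum-ext sortedSpectrum?} _

spectrum-classification : ∀ σ → σ 𝟎 ≡ 0ℙ → Any (λ T → spectrum (sgn ∘ σ) ↭ double T) Tᵃˡˡ
spectrum-classification σ σ𝟎≡0 =
  Any.map (λ {T} → sort-≡⇒↭ (spectrum (sgn ∘ σ)) (double T)) (sortedSpectrum σ σ𝟎≡0)

-- Passage to the rationals

toℚᵘ-fromℤ : ∀ i → toℚᵘ (fromℤ i) ℚᵘ.≃ ℚᵘ.mkℚᵘ i 0
toℚᵘ-fromℤ i = ℚ.toℚᵘ-fromℚᵘ (ℚᵘ.mkℚᵘ i 0)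

fromℤ-+ : ∀ i j → fromℤ (i ℤ.+ j) ≡ fromℤ i ℚ.+ fromℤ j
fromℤ-+ i j = ℚ.toℚᵘ-injective (begin
  toℚᵘ (fromℤ (i ℤ.+ j))                    ≈⟨ toℚᵘ-fromℤ (i ℤ.+ j) ⟩
  ℚᵘ.mkℚᵘ (i ℤ.+ j) 0                       ≈⟨ ℚᵘ.*≡* (unit i j) ⟩
  ℚᵘ.mkℚᵘ i 0 ℚᵘ.+ ℚᵘ.mkℚᵘ j 0              ≈⟨ ℚᵘ.+-cong (toℚᵘ-fromℤ i) (toℚᵘ-fromℤ j) ⟨
  toℚᵘ (fromℤ i) ℚᵘ.+ toℚᵘ (fromℤ j)        ≈⟨ ℚ.toℚᵘ-homo-+ (fromℤ i) (fromℤ j) ⟨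
  toℚᵘ (fromℤ i ℚ.+ fromℤ j)                ∎)
  where
  open ℚᵘ.≃-Reasoning
  unit : ∀ i j → (i ℤ.+ j) ℤ.* 1ℤ ≡ (i ℤ.* 1ℤ ℤ.+ j ℤ.* 1ℤ) ℤ.* 1ℤ
  unit = ℤSolver.solve-∀

fromℤ-* : ∀ i j → fromℤ (i ℤ.* j) ≡ fromℤ i ℚ.* fromℤ j
fromℤ-* i j = ℚ.toℚᵘ-injective (begin
  toℚᵘ (fromℤ (i ℤ.* j))                    ≈⟨ toℚᵘ-fromℤ (i ℤ.* j) ⟩
  ℚᵘ.mkℚᵘ i 0 ℚᵘ.* ℚᵘ.mkℚᵘ j 0              ≈⟨ ℚᵘ.*-cong (toℚᵘ-fromℤ i) (toℚᵘ-fromℤ j) ⟨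
  toℚᵘ (fromℤ i) ℚᵘ.* toℚᵘ (fromℤ j)        ≈⟨ ℚ.toℚᵘ-homo-* (fromℤ i) (fromℤ j) ⟨
  toℚᵘ (fromℤ i ℚ.* fromℤ j)                ∎)
  where open ℚᵘ.≃-Reasoning

⅛ : ℚ
⅛ = + 1 / 8

8x*⅛≡x : ∀ x → fromℤ (+ 8) ℚ.* x ℚ.* ⅛ ≡ x
8x*⅛≡x = solve 1 (λ x → con (fromℤ (+ 8)) :* x :* con ⅛ := x) refl
  where open +-*-Solver

-- Negative exponents occur only for `e` below 3 and are settled by evaluation; from 3 on, a factor
-- 8 cancels against `⅛`.
2^[e-3] : ∀ e → 2^ (+ e ℤ.- + 3) ≡ fromℤ (+ (2 ^ e)) ℚ.* ⅛
2^[e-3] 0 = refl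
2^[e-3] 1 = refl
2^[e-3] 2 = refl
2^[e-3] (suc (suc (suc e))) = begin
  fromℤ (+ (2 ^ e))                                ≡⟨ 8x*⅛≡x (fromℤ (+ (2 ^ e))) ⟨
  fromℤ (+ 8) ℚ.* fromℤ (+ (2 ^ e)) ℚ.* ⅛          ≡⟨ cong (ℚ._* ⅛) (fromℤ-* (+ 8) (+ (2 ^ e))) ⟨
  fromℤ (+ 8 ℤ.* + (2 ^ e)) ℚ.* ⅛                  ≡⟨ cong (λ i → fromℤ i ℚ.* ⅛) (ℤ.pos-* 8 (2 ^ e)) ⟨
  fromℤ (+ (8 * 2 ^ e)) ℚ.* ⅛                      ≡⟨ cong (λ i → fromℤ (+ i) ℚ.* ⅛) (ℕ.^-distribˡ-+-* 2 3 e) ⟨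
  fromℤ (+ (2 ^ (3 ℕ.+ e))) ℚ.* ⅛                  ∎
  where open ≡-Reasoning

-- The 8 is the `2 ^ m` of Fourier inversion for `m` equal to 3. It is removed in ℚ because the
-- exponents n - 3 and k - 3 may be negative.
divide-by-8 : ∀ n k c i → + 8 ℤ.* + c ≡ + (2 ^ n) ℤ.+ + (2 ^ k) ℤ.* i →
  fromℕ c ≡ 2^ (+ n ℤ.- + 3) ℚ.+ 2^ (+ k ℤ.- + 3) ℚ.* fromℤ i
divide-by-8 n k c i eq = begin
  fromℤ (+ c)                                      ≡⟨ 8x*⅛≡x (fromℤ (+ c)) ⟨
  fromℤ (+ 8) ℚ.* fromℤ (+ c) ℚ.* ⅛                ≡⟨ cong (ℚ._* ⅛) (fromℤ-* (+ 8) (+ c)) ⟨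
  fromℤ (+ 8 ℤ.* + c) ℚ.* ⅛                        ≡⟨ cong (λ j → fromℤ j ℚ.* ⅛) eq ⟩
  fromℤ (N ℤ.+ K ℤ.* i) ℚ.* ⅛                      ≡⟨ cong (ℚ._* ⅛) (trans (fromℤ-+ N (K ℤ.* i)) (cong (fromℤ N ℚ.+_) (fromℤ-* K i))) ⟩
  (fromℤ N ℚ.+ fromℤ K ℚ.* fromℤ i) ℚ.* ⅛          ≡⟨ distribute (fromℤ N) (fromℤ K) (fromℤ i) ⅛ ⟩
  fromℤ N ℚ.* ⅛ ℚ.+ fromℤ K ℚ.* ⅛ ℚ.* fromℤ i      ≡⟨ cong₂ (λ p q → p ℚ.+ q ℚ.* fromℤ i) (2^[e-3] n) (2^[e-3] k) ⟨
  2^ (+ n ℤ.- + 3) ℚ.+ 2^ (+ k ℤ.- + 3) ℚ.* fromℤ i  ∎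
  where
  open ≡-Reasoning
  N = + (2 ^ n)
  K = + (2 ^ k)
  distribute : ∀ a b x r → (a ℚ.+ b ℚ.* x) ℚ.* r ≡ a ℚ.* r ℚ.+ b ℚ.* r ℚ.* x
  distribute = solve 4 (λ a b x r → (a :+ b :* x) :* r := a :* r :+ b :* r :* x) refl
    where open +-*-Solver

-- Matching the four distributions

2^≡2^[k-3]*8 : ∀ k → 2^ (+ k) ≡ 2^ (+ k ℤ.- + 3) ℚ.* fromℤ (+ 8)
2^≡2^[k-3]*8 k = trans (*⅛*8 (fromℤ (+ (2 ^ k)))) (cong (ℚ._* fromℤ (+ 8)) (sym (2^[e-3] k)))
  where
  open +-*-Solver
  *⅛*8 : ∀ x → x ≡ x ℚ.* ⅛ ℚ.* fromℤ (+ 8)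
  *⅛*8 = solve 1 (λ x → x := x :* con ⅛ :* con (fromℤ (+ 8))) refl

-- As 2^k is 8 times 2^(k-3), the coefficients of 2^(k-3) are 8 - 1 = 7 and -1, the values of 2T - 1
-- at 4 and 0.
type⁺≡fromT : ∀ n k → type⁺ n k ≡ fromT n k T⁺
type⁺≡fromT n k = cong₂ (λ x y → x ∷ replicate 7 y)
  (trans (cong (λ z → P ℚ.+ z ℚ.- Q) (2^≡2^[k-3]*8 k)) (large P Q)) (small P Q)
  where
  open +-*-Solver
  P = 2^ (+ n ℤ.- + 3)
  Q = 2^ (+ k ℤ.- + 3)
  large : ∀ p q → p ℚ.+ q ℚ.* fromℤ (+ 8) ℚ.- q ≡ p ℚ.+ q ℚ.* fromℤ (+ 7)
  large = solve 2 (λ p q → p :+ q :* con (fromℤ (+ 8)) :- q := p :+ q :* con (fromℤ (+ 7))) refl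
  small : ∀ p q → p ℚ.- q ≡ p ℚ.+ q ℚ.* fromℤ -1ℤ
  small = solve 2 (λ p q → p :- q := p :+ q :* con (fromℤ -1ℤ)) refl

-- Here the coefficients are -8 + 1 = -7 and 1, the values of 2T - 1 at -3 and 1.
type⁻≡fromT : ∀ n k → type⁻ n k ≡ fromT n k T⁻
type⁻≡fromT n k = cong₂ (λ x y → x ∷ replicate 7 y)
  (trans (cong (λ z → P ℚ.- z ℚ.+ Q) (2^≡2^[k-3]*8 k)) (small P Q)) (large P Q)
  where
  open +-*-Solver
  P = 2^ (+ n ℤ.- + 3)
  Q = 2^ (+ k ℤ.- + 3)
  small : ∀ p q → p ℚ.- q ℚ.* fromℤ (+ 8) ℚ.+ q ≡ p ℚ.+ q ℚ.* fromℤ (ℤ.- + 7)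
  small = solve 2 (λ p q → p :- q :* con (fromℤ (+ 8)) :+ q := p :+ q :* con (fromℤ (ℤ.- + 7))) refl
  large : ∀ p q → p ℚ.+ q ≡ p ℚ.+ q ℚ.* fromℤ 1ℤ
  large = solve 2 (λ p q → p :+ q := p :+ q :* con (fromℤ 1ℤ)) refl

fromSpectrum : (n k : ℕ) → List ℤ → List ℚ
fromSpectrum n k = List.map λ s →
  2^ (+ n ℤ.- + 3) ℚ.+ 2^ (+ k ℤ.- + 3) ℚ.* fromℤ (s ℤ.- 1ℤ)

fromSpectrum-double : ∀ n k T → fromSpectrum n k (double T) ≡ fromT n k T
fromSpectrum-double n k T = sym (List.map-∘ T)

-- Both lists follow the order of `vectors`, so they are equal outright; reordering enters only
-- through the classification of spectra.
preimageDistribution≡fromSpectrum : ∀ {n} k (F : 𝔽₂^ n → 𝔽₂^ 3) (f : 𝔽₂^ 3 → ℤ) →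
  (∀ u → walsh F u ≡ + (2 ^ k) ℤ.* f u ℤ.+ (+ (2 ^ n) ℤ.- + (2 ^ k)) ℤ.* 𝟙 (𝟎 ≟ u)) →
  preimageDistribution F ≡ fromSpectrum n k (spectrum f)
preimageDistribution≡fromSpectrum {n} k F f W≡ = trans
  (List.map-cong {g = size ∘ coefficient} sizes (vectors 3))
  (List.map-∘ {g = size} {f = coefficient} (vectors 3))
  where
  size : ℤ → ℚ
  size s = 2^ (+ n ℤ.- + 3) ℚ.+ 2^ (+ k ℤ.- + 3) ℚ.* fromℤ (s ℤ.- 1ℤ)
  coefficient : 𝔽₂^ 3 → ℤ
  coefficient β = ∑[ u ] (χ β u ℤ.* f u)
  sizes : ∀ β → fromℕ (count (λ x → F x ≟ β)) ≡ size (coefficient β)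
  sizes β = divide-by-8 n k (count (λ x → F x ≟ β)) (coefficient β ℤ.- 1ℤ) (fibre-size k F f W≡ β)

theorem5p5 : (n : ℕ) (F : 𝔽₂^ n → 𝔽₂^ 3) → Bent F →
    ∃[ k ] (n ≡ 2 * k ×
    ( preimageDistribution F ↭ type⁺ n k
    ⊎ preimageDistribution F ↭ type⁻ n k
    ⊎ preimageDistribution F ↭ fromT n k Tᴬ
    ⊎ preimageDistribution F ↭ fromT n k Tᴮ ))
theorem5p5 n F bent = k , n≡2k ,
  alternatives (Any.map reach (spectrum-classification σ (proj₁ (proj₂ (sign 𝟎)) refl)))
  where
  -- `1ℙ ∷ 𝟎` serves as a nonzero vector whose Walsh coefficient yields `k`; by `walsh-sign` the
  -- same `k` fits all the others.
  magnitude : ∃[ k ] (n ≡ 2 * k × ∣ walsh F (1ℙ ∷ 𝟎) ∣ ≡ 2 ^ k)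
  magnitude = walsh-magnitude F bent (1ℙ ∷ 𝟎) (λ ())

  k : ℕ
  k = proj₁ magnitude

  n≡2k : n ≡ 2 * k
  n≡2k = proj₁ (proj₂ magnitude)

  sign : ∀ u → ∃[ p ]
    ((u ≡ 𝟎 → p ≡ 0ℙ) ×
     walsh F u ≡ + (2 ^ k) ℤ.* sgn p ℤ.+ (+ (2 ^ n) ℤ.- + (2 ^ k)) ℤ.* 𝟙 (𝟎 ≟ u))
  sign u = walsh-sign k F bent n≡2k u (𝟎 ≟ u)

  σ : 𝔽₂^ 3 → Parity
  σ u = proj₁ (sign u)

  D : List ℚ
  D = preimageDistribution F

  reach : ∀ {T} → spectrum (sgn ∘ σ) ↭ double T → D ↭ fromT n k T
  reach {T} spectrum↭ = subst₂ _↭_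
    (sym (preimageDistribution≡fromSpectrum k F (sgn ∘ σ) (λ u → proj₂ (proj₂ (sign u)))))
    (fromSpectrum-double n k T)
    (map⁺ _ spectrum↭)

  alternatives : Any (λ T → D ↭ fromT n k T) Tᵃˡˡ →
    D ↭ type⁺ n k ⊎ D ↭ type⁻ n k ⊎ D ↭ fromT n k Tᴬ ⊎ D ↭ fromT n k Tᴮ
  alternatives (here p)                         = inj₁ (subst (D ↭_) (sym (type⁺≡fromT n k)) p)
  alternatives (there (here p))                 = inj₂ (inj₁ (subst (D ↭_) (sym (type⁻≡fromT n k)) p))
  alternatives (there (there (here p)))         = inj₂ (inj₂ (inj₁ p))
  alternatives (there (there (there (here p)))) = inj₂ (inj₂ (inj₂ p))
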